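{- Let $n\ge1$. The baseball construction $\mathcal G\mapsto \pi(\mathcal G)$ is a bijection from the set of torsion classes in $A_{n-1}$ to the set of 213-avoiding permutations of $\{1,\dots,n\}$.
   Context: A permutation $p=(m_1,\dots,m_n)$ of $\{1,\dots,n\}$ is 213-avoiding if there are no indices $i<j<k$ with $m_j<m_i<m_k$. Torsion classes in $A_{n-1}$. The objects are balls arranged in a triangle with $n-1$ balls in the bottom row, indexed by pairs $[i,j]$ with $1\le i\le j\le n-1$, with $[i,j]$ drawn at the point $\left(\tfrac{i+j}2,\tfrac{j-i}2\right)$ (no balls if $n=1$). They represent the indecomposable representations of the linearly oriented quiver $A_{n-1}$. $\mathrm{Hom}(X,Y)\neq0$ iff the entire rectangle with left corner $X$ and right corner $Y$ lies in the triangle; explicitly, $\mathrm{Hom}([i,j],[i',j'])\ne0$ iff $i\le i'\le j\le j'$. A pair $(\mathcal G,\mathcal F)$ of subsets of balls is a torsion pair if $\mathcal G=\{X:\mathrm{Hom}(X,Y)=0\ \forall\,Y\in\mathcal F\}$ and $\mathcal F=\{Y:\mathrm{Hom}(X,Y)=0\ \forall\,X\in\mathcal G\}$; a torsion class is the set $\mathcal G$ of some torsion pair. Baseball construction. Given a torsion class $\mathcal G$, call each ball in $\mathcal G$ a baseball and each ball not in $\mathcal G$ a cross-ball. Draw a wire diagram with $n$ wires entering from the right, labeled $1,2,\dots,n$ from top to bottom, and travelling to the left through the balls. Each ball is met by two wires at adjacent heights; at a baseball the two wires do not cross (each keeps its height), and at a cross-ball the two wires cross (exchange heights). The permutation $\pi(\mathcal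 G)$ is the sequence of wire labels read from top to bottom at the left end. Explicitly: start with the sequence $(1,2,\dots,n)$ and process the balls $[i,j]$ in order of decreasing $i+j$ (balls with equal $i+j$ act on disjoint positions, so their order is irrelevant). For a ball $[i,j]$ let $k=n-1-(j-i)$; if $[i,j]\notin\mathcal G$, exchange the entries in positions $k$ and $k+1$ of the current sequence, and if $[i,j]\in\mathcal G$, do nothing. The final sequence is $\pi(\mathcal G)$. -}

module Defs where

open import Data.Bool using (Bool; true; if_then_else_)
open import Data.Fin using (Fin; fromℕ<)
import Data.Fin as Fin
open import Data.Fin.Permutation using (Permutation′; _⟨$⟩ʳ_; _∘ₚ_; transpose)
import Data.Fin.Permutation as Perm
open import Data.List using (List; concatMap; downFrom; foldl; mapMaybe; upTo)
open import Data.Maybe using (Maybe; just; nothing)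
open import Data.Nat using (ℕ; suc; _+_; _∸_; _≤_; _<_; s≤s; _≤?_; _<?_)
open import Data.Nat.Properties using (≤-<-trans; pred[n]≤n; m∸n≤m)
open import Data.Product using (∃; ∃-syntax; Σ-syntax; _×_; _,_; proj₁)
open import Function.Bundles using (_⇔_)
open import Relation.Binary.PropositionalEquality using (_≡_; _≗_)
open import Relation.Nullary using (¬_; yes; no)

-- A permutation (m₁,…,mₙ) of {1,…,n} is σ : Permutation′ n in one-line
-- notation, both positions and values being shifted down by one:
-- toℕ (σ ⟨$⟩ʳ p) + 1 is the entry in position toℕ p + 1.

Avoids213 : ∀ {n} → Permutation′ n → Set
Avoids213 {n} σ =
  ¬ (∃[ i ] ∃[ j ] ∃[ k ] i Fin.< j × j Fin.< k ×
       (σ ⟨$⟩ʳ j) Fin.< (σ ⟨$⟩ʳ i) × (σ ⟨$⟩ʳ i) Fin.< (σ ⟨$⟩ʳ k))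

Av213 : ℕ → Set
Av213 n = Σ[ σ ∈ Permutation′ n ] Avoids213 σ

infix 4 _≈ᵖ_
_≈ᵖ_ : ∀ {n} → Av213 n → Av213 n → Set
σ ≈ᵖ τ = proj₁ σ Perm.≈ proj₁ τ

-- The balls [ i , j ], 1 ≤ i ≤ j ≤ n − 1, of the triangle for A_{n-1}.
record Ball (n : ℕ) : Set where
  constructor ball
  field
    i j  : ℕ
    .1≤i : 1 ≤ i
    .i≤j : i ≤ j
    .j<n : j < n

-- Hom≠0 X Y says Hom(X , Y) ≠ 0.
Hom≠0 : ∀ {n} → Ball n → Ball n → Set
Hom≠0 X Y = X.i ≤ Y.i × Y.i ≤ X.j × X.j ≤ Y.j
  where
  module X = Ball X
  module Y = Ball Y

Hom≡0 : ∀ {n} → Ball n → Ball n → Set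
Hom≡0 X Y = ¬ Hom≠0 X Y

BallSet : ℕ → Set
BallSet n = Ball n → Bool

infix 4 _∈_
_∈_ : ∀ {n} → Ball n → BallSet n → Set
X ∈ S = S X ≡ true

record IsTorsionPair {n : ℕ} (G F : BallSet n) : Set where
  field
    torsion : ∀ X → X ∈ G ⇔ (∀ Y → Y ∈ F → Hom≡0 X Y)
    free    : ∀ Y → Y ∈ F ⇔ (∀ X → X ∈ G → Hom≡0 X Y)

TorsionClass : ℕ → Set
TorsionClass n = Σ[ G ∈ BallSet n ] ∃[ F ] IsTorsionPair G F

-- Equality as sets of balls; the torsion-free part is not compared.
infix 4 _≈ᵗ_
_≈ᵗ_ : ∀ {n} → TorsionClass n → TorsionClass n → Set
G ≈ᵗ H = proj₁ G ≗ proj₁ H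

mkBall? : ∀ {n} → ℕ → ℕ → Maybe (Ball n)
mkBall? {n} i j with 1 ≤? i | i ≤? j | j <? n
... | yes 1≤i | yes i≤j | yes j<n = just (ball i j 1≤i i≤j j<n)
... | _       | _       | _       = nothing

-- All balls by decreasing s = i + j, ties by increasing i.  When s < i the
-- truncated s ∸ i is 0, which mkBall? rejects.
balls : ∀ n → List (Ball n)
balls n = concatMap (λ s → mapMaybe (λ i → mkBall? i (s ∸ i)) (upTo n))
                    (downFrom (n + n))

-- The 1-based position k = n − 1 − (j − i) of the upper wire meeting a ball.
position : ∀ {n} → Ball n → ℕ
position {n} X = n ∸ 1 ∸ (X.j ∸ X.i)
  where module X = Ball X

position<n : ∀ {n} (X : Ball n) → .(Ball.j X < n) → position X < n
position<n {suc n} X _ = s≤s (m∸n≤m n (Ball.j X ∸ Ball.i X))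

-- Positions k and k + 1, shifted down by one.
upper lower : ∀ {n} → Ball n → Fin n
upper X@(ball _ _ _ _ j<n) = fromℕ< (≤-<-trans pred[n]≤n (position<n X j<n))
lower X@(ball _ _ _ _ j<n) = fromℕ< (position<n X j<n)

-- In _∘ₚ_ the left factor acts first, so this exchanges entries by position.
exchange : ∀ {n} → Ball n → Permutation′ n → Permutation′ n
exchange X σ = transpose (upper X) (lower X) ∘ₚ σ

meet : ∀ {n} → BallSet n → Permutation′ n → Ball n → Permutation′ n
meet G σ X = if G X then σ else exchange X σ

π : ∀ {n} → BallSet n → Permutation′ n
π {n} G = foldl (meet G) Perm.id (balls n)

-- A torsion class meets the column { [ i , j ] : 1 ≤ i ≤ j } of balls in those with i > t j, for
-- thresholds 0 ≤ t j ≤ j; thresholds arise in this way iff t j ≤ m < j implies t j ≤ t m, and they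
-- determine the class.  The balls may be processed column by column, j = n − 1 first, because
-- balls incomparable in the product order on (i , j) act on disjoint positions.  Column n − 1 then
-- brings the wire t (n − 1) (counted from 0) to the top and leaves the order of the others
-- unchanged, so t (n − 1) , t (n − 2) , … , t 0 is the Lehmer code of π(G).  A
-- permutation starting with c avoids 213 iff its remainder does and no entry below c precedes one
-- above c; read off the Lehmer code, this is the condition on t above.

module Submission where

open import Defs
open import Data.Nat using (ℕ; _≥_)
open import Data.Product using (Σ; _,_; proj₁)
open import Function.Structures using (IsBijection)

open import Data.Bool using (Bool; true; false; if_then_else_)
open import Data.Bool.Properties using (if-cong; if-eta; if-float; ¬-not)
open import Data.Fin using (Fin; zero; suc; toℕ; fromℕ; inject₁; punchIn)
import Data.Fin as Fin
import Data.Fin.Permutation as Perm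
open import Data.Fin.Permutation using (Permutation′; _⟨$⟩ʳ_; _⟨$⟩ˡ_; inverseʳ; insert; insert-punchIn; insert-remove; remove)
open import Data.Fin.Permutation.Components using (transpose)
open import Data.Fin.Properties using (toℕ-injective; toℕ<n; toℕ-fromℕ; toℕ-fromℕ<; toℕ-inject₁; punchIn-injective)
open import Data.List using (List; []; _∷_; _++_; map; mapMaybe; foldl; foldr; upTo; downFrom)
import Data.List.Membership.Propositional as List
open import Data.List.Membership.Propositional.Properties using (∈-++⁺ˡ; ∈-++⁺ʳ; ∈-++⁻; ∈-∃++; ∈-map⁺; ∈-concatMap⁺; ∈-upTo⁺; ∈-downFrom⁺)
open import Data.List.Properties using (foldr-++; foldr-cong; foldr-fusion)
open import Data.List.Relation.Unary.All as All using (All; []; _∷_)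
import Data.List.Relation.Unary.All.Properties as All
open import Data.List.Relation.Unary.AllPairs as AllPairs using (AllPairs; []; _∷_)
import Data.List.Relation.Unary.AllPairs.Properties as AllPairs
open import Data.List.Relation.Unary.Any as Any using (here; there)
import Data.List.Relation.Unary.Any.Properties as Any
open import Data.Maybe using (Maybe; just; nothing; maybe′)
import Data.Maybe.Relation.Unary.All as MaybeAll
import Data.Maybe.Relation.Unary.Any as MaybeAny
open import Data.Nat using (zero; suc; pred; _+_; _∸_; _⊓_; _≤_; _<_; z≤n; s≤s; s≤s⁻¹; >-nonZero; _≤?_; _<?_; _≟_)
open import Data.Nat.Properties hiding (_≤?_; _<?_; _≟_)
open import Data.Product using (_×_; ∃-syntax)
open import Data.Sum using (_⊎_; inj₁; inj₂; [_,_]′)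
open import Function using (_∘_; id)
open import Function.Bundles using (mk⇔; module Equivalence)
open import Relation.Binary.PropositionalEquality
open import Relation.Nullary using (¬_; Dec; yes; no; does; contradiction)
open import Relation.Nullary.Decidable using (dec-true; dec-false; recompute; _→-dec_)

open Equivalence using (to; from)

-- Folding commuting actions over two sortings of the same elements

∈-middle⁺ : ∀ {A : Set} {x y : A} as {bs} → x List.∈ as ++ bs → x List.∈ as ++ y ∷ bs
∈-middle⁺ as x∈ with ∈-++⁻ as x∈
... | inj₁ x∈as = ∈-++⁺ˡ x∈as
... | inj₂ x∈bs = ∈-++⁺ʳ as (there x∈bs)

∈-middle⁻ : ∀ {A : Set} {x y : A} as {bs} → x List.∈ as ++ y ∷ bs → x ≡ y ⊎ x List.∈ as ++ bs
∈-middle⁻ as x∈ with ∈-++⁻ as x∈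
... | inj₁ x∈as         = inj₂ (∈-++⁺ˡ x∈as)
... | inj₂ (here x≡y)   = inj₁ x≡y
... | inj₂ (there x∈bs) = inj₂ (∈-++⁺ʳ as x∈bs)

AllPairs-middle : ∀ {A : Set} {R : A → A → Set} {y} as {bs} → AllPairs R (as ++ y ∷ bs) →
                  AllPairs R (as ++ bs) × All (λ a → R a y) as × All (R y) bs
AllPairs-middle []       (py ∷ ps) = ps , [] , py
AllPairs-middle (a ∷ as) (pa ∷ ps) with AllPairs-middle as ps | All.++⁻ as pa
... | qs , qy , yq | pas , ay ∷ pbs = All.++⁺ pas pbs ∷ qs , ay ∷ qy , yq

module _ {A B : Set} (R : A → A → Set) (act : A → B → B)
         (irrefl : ∀ {x} → ¬ R x x)
         (commute : ∀ {x y} → R x y → R y x → ∀ b → act x (act y b) ≡ act y (act x b))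
         where

  private
    foldr-pull : ∀ {y} as bs → All (λ a → R a y × R y a) as → ∀ b →
                 foldr act b (as ++ y ∷ bs) ≡ act y (foldr act b (as ++ bs))
    foldr-pull []       bs []              b = refl
    foldr-pull (a ∷ as) bs ((ay , ya) ∷ r) b =
      trans (cong (act a) (foldr-pull as bs r b)) (commute ay ya _)

  -- Induction on `ys`: its head `y` occurs in `xs`, and whatever stands before `y` there is related
  -- to it both ways, by the sortedness of `xs` and of `ys`, so `act y` commutes to the front.
  -- Irreflexivity rules out repetitions, so equal membership is enough.
  foldr-sorted : ∀ xs ys → AllPairs R xs → AllPairs R ys →
                 (∀ {x} → x List.∈ xs → x List.∈ ys) → (∀ {x} → x List.∈ ys → x List.∈ xs) →
                 ∀ b → foldr act b xs ≡ foldr act b ys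
  foldr-sorted []      []       _  _         _ _ b = refl
  foldr-sorted (x ∷ _) []       _  _         f _ b with () ← f (here refl)
  foldr-sorted xs      (y ∷ ys) Rx (py ∷ Ry) f g b with ∈-∃++ (g (here refl))
  ... | as , bs , refl with AllPairs-middle as Rx
  ...   | Rx′ , Ray , Ryb =
    trans (foldr-pull as bs (All.tabulate λ a∈ → All.lookup Ray a∈ , before a∈) b)
          (cong (act y) (foldr-sorted (as ++ bs) ys Rx′ Ry f′ g′ b))
    where
    before : ∀ {a} → a List.∈ as → R y a
    before a∈ with f (∈-++⁺ˡ a∈)
    ... | here refl = contradiction (All.lookup Ray a∈) irrefl
    ... | there a∈′ = All.lookup py a∈′

    f′ : ∀ {x} → x List.∈ as ++ bs → x List.∈ ys
    f′ x∈ with f (∈-middle⁺ as x∈)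
    ... | there x∈ys = x∈ys
    ... | here refl with ∈-++⁻ as x∈
    ...   | inj₁ x∈as = contradiction (All.lookup Ray x∈as) irrefl
    ...   | inj₂ x∈bs = contradiction (All.lookup Ryb x∈bs) irrefl

    g′ : ∀ {x} → x List.∈ ys → x List.∈ as ++ bs
    g′ x∈ with ∈-middle⁻ as (g (there x∈))
    ... | inj₁ refl = contradiction (All.lookup py x∈) irrefl
    ... | inj₂ x∈′  = x∈′

AllPairs-mapMaybe⁺ : ∀ {A B : Set} {R : B → B → Set} (f : A → Maybe B) {xs} →
                     AllPairs (λ a b → ∀ {x y} → f a ≡ just x → f b ≡ just y → R x y) xs →
                     AllPairs R (mapMaybe f xs)
AllPairs-mapMaybe⁺ f [] = []
AllPairs-mapMaybe⁺ {R = R} f {a ∷ xs} (pa ∷ ps) with f a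
... | nothing = AllPairs-mapMaybe⁺ f ps
... | just x  = All.mapMaybe⁺ (All.map⁺ (All.map related pa)) ∷ AllPairs-mapMaybe⁺ f ps
  where
  related : ∀ {b} → (∀ {x′ y} → just x ≡ just x′ → f b ≡ just y → R x′ y) → MaybeAll.All (R x) (f b)
  related {b} r with f b
  ... | nothing = MaybeAll.nothing
  ... | just y  = MaybeAll.just (r refl refl)

does-true : ∀ {A : Set} (a? : Dec A) → does a? ≡ true → A
does-true (yes a) _ = a

-- Adjacent transpositions and punching in, on ℕ

adj : ℕ → ℕ → ℕ
adj zero    zero          = 1
adj zero    (suc zero)    = 0
adj zero    (suc (suc p)) = suc (suc p)
adj (suc k) zero          = 0
adj (suc k) (suc p)       = suc (adj k p)

adj-here : ∀ k → adj k k ≡ suc k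
adj-here zero    = refl
adj-here (suc k) = cong suc (adj-here k)

adj-next : ∀ k → adj k (suc k) ≡ k
adj-next zero    = refl
adj-next (suc k) = cong suc (adj-next k)

adj-other : ∀ k p → p ≢ k → p ≢ suc k → adj k p ≡ p
adj-other zero    zero          p≢k _   = contradiction refl p≢k
adj-other zero    (suc zero)    _   p≢1 = contradiction refl p≢1
adj-other zero    (suc (suc p)) _   _   = refl
adj-other (suc k) zero          _   _   = refl
adj-other (suc k) (suc p)       a   b   = cong suc (adj-other k p (a ∘ cong suc) (b ∘ cong suc))

adj-commute : ∀ a b → suc a < b → ∀ p → adj a (adj b p) ≡ adj b (adj a p)
adj-commute zero    (suc (suc b)) _         zero          = refl
adj-commute zero    (suc (suc b)) _         (suc zero)    = refl
adj-commute zero    (suc (suc b)) _         (suc (suc p)) = refl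
adj-commute (suc a) (suc b)       _         zero          = refl
adj-commute (suc a) (suc b)       (s≤s a<b) (suc p)       = cong suc (adj-commute a b a<b p)
adj-commute zero    (suc zero)    (s≤s ())  _

toℕ-transpose : ∀ {n} (i j k : Fin n) → toℕ j ≡ suc (toℕ i) → toℕ (transpose i j k) ≡ adj (toℕ i) (toℕ k)
toℕ-transpose i j k eq with k Fin.≟ i
... | yes refl = trans eq (sym (adj-here (toℕ i)))
... | no  k≢i with k Fin.≟ j
...   | yes refl = sym (trans (cong (adj (toℕ i)) eq) (adj-next (toℕ i)))
...   | no  k≢j  = sym (adj-other (toℕ i) (toℕ k) (k≢i ∘ toℕ-injective)
                         (λ e → k≢j (toℕ-injective (trans e (sym eq)))))

punch : ℕ → ℕ → ℕ
punch zero    x       = suc x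
punch (suc c) zero    = 0
punch (suc c) (suc x) = suc (punch c x)

toℕ-punchIn : ∀ {n} (c : Fin (suc n)) x → toℕ (punchIn c x) ≡ punch (toℕ c) (toℕ x)
toℕ-punchIn zero    x       = refl
toℕ-punchIn (suc c) zero    = refl
toℕ-punchIn (suc c) (suc x) = cong suc (toℕ-punchIn c x)

punch-< : ∀ c {x} → x < c → punch c x ≡ x
punch-< (suc c) {zero}  _   = refl
punch-< (suc c) {suc x} x<c = cong suc (punch-< c (s≤s⁻¹ x<c))

punch-≥ : ∀ c {x} → c ≤ x → punch c x ≡ suc x
punch-≥ zero    _         = refl
punch-≥ (suc c) (s≤s c≤x) = cong suc (punch-≥ c c≤x)

punch-inflationary : ∀ c x → x ≤ punch c x
punch-inflationary c x with x <? c
... | yes x<c = ≤-reflexive (sym (punch-< c x<c))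
... | no  x≮c = ≤-trans (n≤1+n x) (≤-reflexive (sym (punch-≥ c (≮⇒≥ x≮c))))

punch-mono-< : ∀ c {x y} → x < y → punch c x < punch c y
punch-mono-< zero                    x<y       = s≤s x<y
punch-mono-< (suc c) {zero}  {suc y} _         = s≤s z≤n
punch-mono-< (suc c) {suc x} {suc y} (s≤s x<y) = s≤s (punch-mono-< c x<y)

punch-cancel-< : ∀ c {x y} → punch c x < punch c y → x < y
punch-cancel-< zero                    (s≤s x<y) = x<y
punch-cancel-< (suc c) {zero}  {suc y} _         = s≤s z≤n
punch-cancel-< (suc c) {suc x} {suc y} (s≤s x<y) = s≤s (punch-cancel-< c x<y)

-- The position reached from p by the transpositions 0, 1, …, i − 1 in turn.
rotate : ℕ → ℕ → ℕ
rotate i zero    = i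
rotate i (suc q) = punch i q

rotate-zero : ∀ p → rotate 0 p ≡ p
rotate-zero zero    = refl
rotate-zero (suc p) = refl

-- `punch i` leaves out exactly the value i; exchanging i and i + 1 moves this gap up by one.
adj-punch : ∀ i q → adj i (punch i q) ≡ punch (suc i) q
adj-punch zero    zero    = refl
adj-punch zero    (suc q) = refl
adj-punch (suc i) zero    = refl
adj-punch (suc i) (suc q) = cong suc (adj-punch i q)

adj-rotate : ∀ i p → adj i (rotate i p) ≡ rotate (suc i) p
adj-rotate i zero    = adj-here i
adj-rotate i (suc q) = adj-punch i q

-- Geometry of the triangle

-- The bounds of a `Ball` are irrelevant; deciding them again makes them usable in proofs.
1≤i : ∀ {n} (X : Ball n) → 1 ≤ Ball.i X
1≤i (ball i _ 1≤i _ _) = recompute (1 ≤? i) 1≤i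

i≤j : ∀ {n} (X : Ball n) → Ball.i X ≤ Ball.j X
i≤j (ball i j _ i≤j _) = recompute (i ≤? j) i≤j

j<n : ∀ {n} (X : Ball n) → Ball.j X < n
j<n {n} (ball _ j _ _ j<n) = recompute (j <? n) j<n

height<n∸1 : ∀ {n} (X : Ball n) → Ball.j X ∸ Ball.i X < n ∸ 1
height<n∸1 X = <-≤-trans (∸-monoʳ-< (1≤i X) (i≤j X)) (<⇒≤pred (j<n X))

-- The value of `upper`, counted from 0; `pred` loses nothing because `height<n∸1` keeps the
-- position positive.
row : ∀ {n} → Ball n → ℕ
row X = pred (position X)

position≡suc-row : ∀ {n} (X : Ball n) → position X ≡ suc (row X)
position≡suc-row X = sym (suc-pred (position X) {{>-nonZero (m<n⇒0<n∸m (height<n∸1 X))}})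

infix 4 _⋠_
-- Read as: `X` may be processed before `Y`. Balls related both ways are the incomparable ones,
-- which have to commute.
_⋠_ : ∀ {n} → Ball n → Ball n → Set
X ⋠ Y = ¬ (Ball.i X ≤ Ball.i Y × Ball.j X ≤ Ball.j Y)

step : ∀ {n} → BallSet n → Ball n → ℕ → ℕ
step G X p = if G X then p else adj (row X) p

-- Both ends move strictly inwards, so the heights differ by at least 2, the distance that
-- `adj-commute` asks for.
nested⇒rows-apart : ∀ {n} (X Y : Ball n) → Ball.i X < Ball.i Y → Ball.j Y < Ball.j X → suc (row X) < row Y
nested⇒rows-apart {n} X Y i<i′ j′<j =
  s≤s⁻¹ (subst₂ (λ x y → suc x < y) (position≡suc-row X) (position≡suc-row Y) positions)
  where
  module X = Ball X
  module Y = Ball Y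

  heights : suc (Y.j ∸ Y.i) < X.j ∸ X.i
  heights = ≤-<-trans (∸-monoʳ-< i<i′ (i≤j Y))
              (∸-monoˡ-< j′<j (≤-trans (<⇒≤ i<i′) (i≤j Y)))

  positions : suc (position X) < position Y
  positions = ≤-<-trans (∸-monoʳ-< heights (<⇒≤ (height<n∸1 X)))
                (∸-monoʳ-< ≤-refl (<⇒≤ (<-trans heights (height<n∸1 X))))

-- A baseball acts as the identity. Of two incomparable balls, one interval lies strictly inside the
-- other at both ends, so their transpositions are apart.
step-commute : ∀ {n} (G : BallSet n) (X Y : Ball n) → X ⋠ Y → Y ⋠ X →
               ∀ p → step G X (step G Y p) ≡ step G Y (step G X p)
step-commute G X Y X⋠Y Y⋠X p with G X | G Y
... | true  | _     = refl
... | false | true  = refl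
... | false | false with Ball.i X <? Ball.i Y
...   | yes i<i′ = adj-commute _ _ (nested⇒rows-apart X Y i<i′ (≰⇒> λ j≤j′ → X⋠Y (<⇒≤ i<i′ , j≤j′))) p
...   | no  i≮i′ = sym (adj-commute _ _ (nested⇒rows-apart Y X i′<i j<j′) p)
  where
  j<j′ : Ball.j X < Ball.j Y
  j<j′ = ≰⇒> λ j′≤j → Y⋠X (≮⇒≥ i≮i′ , j′≤j)

  i′<i : Ball.i Y < Ball.i X
  i′<i = ≰⇒> λ i≤i′ → X⋠Y (i≤i′ , <⇒≤ j<j′)

-- Enumeration of the balls by diagonals

mkBall?-just : ∀ {n} i j {X : Ball n} → mkBall? i j ≡ just X → Ball.i X ≡ i × Ball.j X ≡ j
mkBall?-just {n} i j eq with 1 ≤? i | i ≤? j | j <? n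
mkBall?-just i j refl | yes _ | yes _ | yes _ = refl , refl

mkBall?-complete : ∀ {n} (X : Ball n) → mkBall? (Ball.i X) (Ball.j X) ≡ just X
mkBall?-complete {n} X@(ball i j _ _ _) with 1 ≤? i | i ≤? j | j <? n
... | yes _   | yes _   | yes _   = refl
... | no  1≰i | _       | _       = contradiction (1≤i X) 1≰i
... | yes _   | no  i≰j | _       = contradiction (i≤j X) i≰j
... | yes _   | yes _   | no  j≮n = contradiction (j<n X) j≮n

diagonal : ∀ n → ℕ → List (Ball n)
diagonal n s = mapMaybe (λ i → mkBall? i (s ∸ i)) (upTo n)

mkBall?-sum : ∀ {n} i s {X : Ball n} → mkBall? i (s ∸ i) ≡ just X → Ball.i X + Ball.j X ≡ s
mkBall?-sum i s {X} eq with mkBall?-just i (s ∸ i) eq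
... | refl , j≡s∸i = trans (cong (i +_) j≡s∸i) (m+[n∸m]≡n i≤s)
  where
  -- A ball has i ≤ j, and here j is s ∸ i ≤ s, so the subtraction is not truncated.
  i≤s : i ≤ s
  i≤s = ≤-trans (i≤j X) (≤-trans (≤-reflexive j≡s∸i) (m∸n≤m s i))

diagonal-sum : ∀ n s → All (λ X → Ball.i X + Ball.j X ≡ s) (diagonal n s)
diagonal-sum n s = All.mapMaybe⁺ (All.map⁺ (All.universal onSum (upTo n)))
  where
  onSum : ∀ i → MaybeAll.All (λ X → Ball.i X + Ball.j X ≡ s) (mkBall? {n} i (s ∸ i))
  onSum i with mkBall? {n} i (s ∸ i) in eq
  ... | nothing = MaybeAll.nothing
  ... | just X  = MaybeAll.just (mkBall?-sum i s eq)

diagonal-sorted : ∀ n s → AllPairs _⋠_ (diagonal n s)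
diagonal-sorted n s =
  AllPairs-mapMaybe⁺ (λ i → mkBall? i (s ∸ i)) (AllPairs.applyUpTo⁺₁ id n λ i<i′ _ → sorted i<i′)
  where
  sorted : ∀ {i i′} → i < i′ → ∀ {X Y : Ball n} →
           mkBall? i (s ∸ i) ≡ just X → mkBall? i′ (s ∸ i′) ≡ just Y → X ⋠ Y
  sorted {i} {i′} i<i′ {X} {Y} eqX eqY (_ , j≤j′) = <-irrefl sums (+-mono-<-≤ iX<iY j≤j′)
    where
    sums : Ball.i X + Ball.j X ≡ Ball.i Y + Ball.j Y
    sums = trans (mkBall?-sum i s eqX) (sym (mkBall?-sum i′ s eqY))

    iX<iY : Ball.i X < Ball.i Y
    iX<iY = subst₂ _<_ (sym (proj₁ (mkBall?-just i _ eqX))) (sym (proj₁ (mkBall?-just i′ _ eqY))) i<i′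

-- Comparable balls have comparable sums i + j, and the sum drops from one diagonal to the next.
balls-sorted : ∀ n → AllPairs _⋠_ (balls n)
balls-sorted n = AllPairs.concat⁺ (All.map⁺ (All.universal (diagonal-sorted n) (downFrom (n + n))))
  (AllPairs.map⁺ (AllPairs.applyDownFrom⁺₁ id (n + n) λ s′<s _ → sorted s′<s))
  where
  sorted : ∀ {s s′} → s′ < s → All (λ X → All (X ⋠_) (diagonal n s′)) (diagonal n s)
  sorted {s} {s′} s′<s = All.map (λ eqX → All.map (λ eqY (i≤i′ , j≤j′) →
    <⇒≱ s′<s (subst₂ _≤_ eqX eqY (+-mono-≤ i≤i′ j≤j′))) (diagonal-sum n s′)) (diagonal-sum n s)

∈-balls : ∀ {n} (X : Ball n) → X List.∈ balls n
∈-balls {n} X = ∈-concatMap⁺ (diagonal n) (Any.map inDiagonal (∈-downFrom⁺ i+j<n+n))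
  where
  open Ball X using (i; j)

  i<n : i < n
  i<n = ≤-<-trans (i≤j X) (j<n X)

  i+j<n+n : i + j < n + n
  i+j<n+n = +-mono-< i<n (j<n X)

  inDiagonal : ∀ {s} → i + j ≡ s → X List.∈ diagonal n s
  inDiagonal refl = Any.mapMaybe⁺ (λ i′ → mkBall? i′ (i + j ∸ i′)) (upTo n)
    (Any.map⁺ (Any.map found (∈-upTo⁺ i<n)))
    where
    found : ∀ {i′} → i ≡ i′ → MaybeAny.Any (X ≡_) (mkBall? {n} i′ (i + j ∸ i′))
    found refl rewrite m+n∸m≡n i j | mkBall?-complete X = MaybeAny.just refl

-- The entry at position `p` is found by following its wire from the left end back to the right.
-- Thus the ball processed last acts first, which turns `foldl` into `foldr`.
π-foldr : ∀ {n} (G : BallSet n) p → toℕ (π G ⟨$⟩ʳ p) ≡ foldr (step G) (toℕ p) (balls n)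
π-foldr {n} G p = trans (cong toℕ (unfold (balls n) Perm.id))
                        (foldr-fusion toℕ p toℕ-step (balls n))
  where
  stepF : Ball n → Fin n → Fin n
  stepF X q = if G X then q else transpose (upper X) (lower X) q

  meet-step : ∀ σ X q → meet G σ X ⟨$⟩ʳ q ≡ σ ⟨$⟩ʳ stepF X q
  meet-step σ X q with G X
  ... | true  = refl
  ... | false = refl

  unfold : ∀ xs σ → foldl (meet G) σ xs ⟨$⟩ʳ p ≡ σ ⟨$⟩ʳ foldr stepF p xs
  unfold []       σ = refl
  unfold (X ∷ xs) σ = trans (unfold xs (meet G σ X)) (meet-step σ X _)

  toℕ-step : ∀ X q → toℕ (stepF X q) ≡ step G X (toℕ q)
  toℕ-step X q with G X
  ... | true  = refl
  ... | false = trans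
    (toℕ-transpose (upper X) (lower X) q
      (trans (toℕ-fromℕ< _) (trans (position≡suc-row X) (cong suc (sym (toℕ-fromℕ< _))))))
    (cong (λ r → adj r (toℕ q)) (toℕ-fromℕ< _))

π-cong : ∀ {n} {G H : BallSet n} → G ≗ H → ∀ p → π G ⟨$⟩ʳ p ≡ π H ⟨$⟩ʳ p
π-cong {n} {G} {H} G≗H p = toℕ-injective (begin
  toℕ (π G ⟨$⟩ʳ p)                    ≡⟨ π-foldr G p ⟩
  foldr (step G) (toℕ p) (balls n)    ≡⟨ foldr-cong (λ X q → cong (if_then q else adj (row X) q) (G≗H X)) refl (balls n) ⟩
  foldr (step H) (toℕ p) (balls n)    ≡⟨ π-foldr H p ⟨
  toℕ (π H ⟨$⟩ʳ p)                    ∎)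
  where open ≡-Reasoning

-- Thresholds and Lehmer codes

-- Indexed by all of ℕ so that one `t` serves every n in the inductions; its type also lets `t n` be
-- the first entry of a permutation of size n + 1.
Thresholds : Set
Thresholds = ∀ j → Fin (suc j)

above : Thresholds → ∀ {n} → BallSet n
above t X = does (toℕ (t (Ball.j X)) <? Ball.i X)

lehmer : Thresholds → ∀ n → Permutation′ n
lehmer t zero    = Perm.id
lehmer t (suc n) = insert zero (t n) (lehmer t n)

toℕ-insert-suc : ∀ {n} (c : Fin (suc n)) (σ : Permutation′ n) p →
                 toℕ (insert zero c σ ⟨$⟩ʳ suc p) ≡ punch (toℕ c) (toℕ (σ ⟨$⟩ʳ p))
toℕ-insert-suc c σ p = trans (cong toℕ (insert-punchIn zero c σ p)) (toℕ-punchIn c _)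

-- Splitting off the last column of the triangle

embed : ∀ {n} → Ball n → Ball (suc n)
embed X = ball (Ball.i X) (Ball.j X) (1≤i X) (i≤j X) (m<n⇒m<1+n (j<n X))

-- A ball keeps its height above the bottom row, but positions count from the top, where the larger
-- triangle has one more wire.
row-embed : ∀ {n} (X : Ball n) → row (embed X) ≡ suc (row X)
row-embed {n} X = begin
  pred (n ∸ h)   ≡⟨ pred[m∸n]≡m∸[1+n] n h ⟩
  n ∸ suc h      ≡⟨ ∸-+-assoc n 1 h ⟨
  n ∸ 1 ∸ h      ≡⟨ position≡suc-row X ⟩
  suc (row X)    ∎
  where
  open ≡-Reasoning
  h = Ball.j X ∸ Ball.i X

column : ∀ {n} m → .(m ≤ n) → List (Ball (suc n))
column     zero    _   = []
column {n} (suc m) m<n = ball (suc m) n (s≤s z≤n) m<n ≤-refl ∷ column m (<⇒≤ m<n)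

column-bounds : ∀ {n} m .(m≤n : m ≤ n) → All (λ X → Ball.i X ≤ m × Ball.j X ≡ n) (column m m≤n)
column-bounds zero    _   = []
column-bounds (suc m) m<n = (≤-refl , refl) ∷ All.map (λ (i≤m , e) → m≤n⇒m≤1+n i≤m , e) (column-bounds m (<⇒≤ m<n))

column-sorted : ∀ {n} m .(m≤n : m ≤ n) → AllPairs _⋠_ (column m m≤n)
column-sorted zero    _   = []
column-sorted (suc m) m<n =
  All.map (λ (i≤m , _) (m<i , _) → <⇒≱ m<i i≤m) (column-bounds m (<⇒≤ m<n)) ∷ column-sorted m (<⇒≤ m<n)

∈-column : ∀ {n} m .(m≤n : m ≤ n) (X : Ball (suc n)) → Ball.i X ≤ m → Ball.j X ≡ n → X List.∈ column m m≤n
∈-column zero    _   X i≤0 _    = contradiction (≤-trans (1≤i X) i≤0) λ ()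
∈-column (suc m) m<n X i≤  j≡n with m≤n⇒m<n∨m≡n i≤
... | inj₁ i≤m = there (∈-column m (<⇒≤ m<n) X (s≤s⁻¹ i≤m) j≡n)
∈-column (suc m) m<n (ball _ _ _ _ _) _ refl | inj₂ refl = here refl

-- A second order compatible with `_⋠_`, suited to induction on n.
columnFirst : ∀ n → List (Ball (suc n))
columnFirst n = column n ≤-refl ++ map embed (balls n)

columnFirst-sorted : ∀ n → AllPairs _⋠_ (columnFirst n)
columnFirst-sorted n = AllPairs.++⁺ (column-sorted n ≤-refl) (AllPairs.map⁺ (balls-sorted n))
  (All.map (λ (_ , j≡n) → All.map⁺ (All.universal (λ Y (_ , j≤j′) →
    <⇒≱ (j<n Y) (subst (_≤ Ball.j Y) j≡n j≤j′)) (balls n))) (column-bounds n ≤-refl))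

∈-columnFirst : ∀ {n} (X : Ball (suc n)) → X List.∈ columnFirst n
∈-columnFirst {n} X = [ inEarlier , inLast ]′ (m≤n⇒m<n∨m≡n (s≤s⁻¹ (j<n X)))
  where
  inEarlier : Ball.j X < n → X List.∈ columnFirst n
  inEarlier j<n = ∈-++⁺ʳ (column n ≤-refl)
    (∈-map⁺ embed (∈-balls (ball (Ball.i X) (Ball.j X) (1≤i X) (i≤j X) j<n)))

  inLast : Ball.j X ≡ n → X List.∈ columnFirst n
  inLast j≡n = ∈-++⁺ˡ (∈-column n ≤-refl X (≤-trans (i≤j X) (≤-reflexive j≡n)) j≡n)

step-embed : ∀ {n} (G : BallSet (suc n)) X p →
             step G (embed X) p ≡ (if G (embed X) then p else adj (suc (row X)) p)
step-embed G X p = cong (λ r → if G (embed X) then p else adj r p) (row-embed X)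

-- The embedded balls have rows at least 1, so the top wire passes above them all.
foldr-embed-zero : ∀ {n} (G : BallSet (suc n)) xs → foldr (step G) 0 (map embed xs) ≡ 0
foldr-embed-zero G []       = refl
foldr-embed-zero G (X ∷ xs) = begin
  step G (embed X) (foldr (step G) 0 (map embed xs))  ≡⟨ cong (step G (embed X)) (foldr-embed-zero G xs) ⟩
  step G (embed X) 0                                  ≡⟨ step-embed G X 0 ⟩
  (if G (embed X) then 0 else 0)                      ≡⟨ if-eta (G (embed X)) ⟩
  0                                                   ∎
  where open ≡-Reasoning

-- All rows are shifted by one, and `adj (suc k) (suc p)` computes to `suc (adj k p)`.
foldr-embed-suc : ∀ {n} (G : BallSet (suc n)) p xs →
                  foldr (step G) (suc p) (map embed xs) ≡ suc (foldr (step (G ∘ embed)) p xs)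
foldr-embed-suc G p []       = refl
foldr-embed-suc G p (X ∷ xs) = begin
  step G (embed X) (foldr (step G) (suc p) (map embed xs))     ≡⟨ cong (step G (embed X)) (foldr-embed-suc G p xs) ⟩
  step G (embed X) (suc q)                                     ≡⟨ step-embed G X (suc q) ⟩
  (if G (embed X) then suc q else suc (adj (row X) q))         ≡⟨ if-float suc (G (embed X)) ⟨
  suc (step (G ∘ embed) X q)                                   ∎
  where
  open ≡-Reasoning
  q = foldr (step (G ∘ embed)) p xs

-- The ball [ i , n ] lies in row i - 1, and [ 1 , n ] acts first. The cross-balls are those with i
-- ≤ t n, so the transpositions 0, 1, ... below m ⊓ t n act in turn.
foldr-column : ∀ t {n} m .(m≤n : m ≤ n) p →
               foldr (step (above t)) p (column m m≤n) ≡ rotate (m ⊓ toℕ (t n)) p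
foldr-column t         zero    _   p = sym (rotate-zero p)
foldr-column t {n} (suc m) m<n p = trans (cong (step (above t) top) (foldr-column t m (<⇒≤ m<n) p)) last
  where
  open ≡-Reasoning
  top : Ball (suc n)
  top = ball (suc m) n (s≤s z≤n) m<n ≤-refl
  c = toℕ (t n)

  last : step (above t) top (rotate (m ⊓ c) p) ≡ rotate (suc m ⊓ c) p
  last with c <? suc m
  ... | yes c<1+m = begin
    step (above t) top (rotate (m ⊓ c) p)   ≡⟨ if-cong (dec-true (c <? suc m) c<1+m) ⟩
    rotate (m ⊓ c) p                        ≡⟨ cong (λ r → rotate r p) (m≥n⇒m⊓n≡n (s≤s⁻¹ c<1+m)) ⟩
    rotate c p                              ≡⟨ cong (λ r → rotate r p) (m≥n⇒m⊓n≡n (<⇒≤ c<1+m)) ⟨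
    rotate (suc m ⊓ c) p                    ∎
  ... | no  c≮1+m = begin
    step (above t) top (rotate (m ⊓ c) p)   ≡⟨ if-cong (dec-false (c <? suc m) c≮1+m) ⟩
    adj (row top) (rotate (m ⊓ c) p)        ≡⟨ cong₂ (λ k r → adj (pred k) (rotate r p))
                                                 (m∸[m∸n]≡n (recompute (suc m ≤? n) m<n))
                                                 (m≤n⇒m⊓n≡m (<⇒≤ (≮⇒≥ c≮1+m))) ⟩
    adj m (rotate m p)                      ≡⟨ adj-rotate m p ⟩
    rotate (suc m) p                        ≡⟨ cong (λ r → rotate r p) (m≤n⇒m⊓n≡m (≮⇒≥ c≮1+m)) ⟨
    rotate (suc m ⊓ c) p                    ∎

-- Both orders of the balls are sorted, so `columnFirst` may replace `balls`; its last column
-- contributes a single `rotate`.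
foldr-balls-suc : ∀ t n p → foldr (step (above t)) p (balls (suc n)) ≡
                  rotate (toℕ (t n)) (foldr (step (above t)) p (map embed (balls n)))
foldr-balls-suc t n p = begin
  foldr (step (above t)) p (balls (suc n))
    ≡⟨ foldr-sorted _⋠_ (step {suc n} (above t)) (λ X⋠X → X⋠X (≤-refl , ≤-refl))
         (λ {X} {Y} → step-commute (above t) X Y)
         (balls (suc n)) (columnFirst n) (balls-sorted (suc n)) (columnFirst-sorted n)
         (λ {X} _ → ∈-columnFirst X) (λ {X} _ → ∈-balls X) p ⟩
  foldr (step (above t)) p (columnFirst n)
    ≡⟨ foldr-++ (step (above t)) p (column n ≤-refl) (map embed (balls n)) ⟩
  foldr (step (above t)) rest (column n ≤-refl)
    ≡⟨ foldr-column t n ≤-refl rest ⟩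
  rotate (n ⊓ toℕ (t n)) rest
    ≡⟨ cong (λ r → rotate r rest) (m≥n⇒m⊓n≡n (s≤s⁻¹ (toℕ<n (t n)))) ⟩
  rotate (toℕ (t n)) rest ∎
  where
  open ≡-Reasoning
  rest = foldr (step (above t)) p (map embed (balls n))

-- Position 0 is sent to t n by `rotate`; any other position passes through the smaller triangle and
-- is then punched around t n, as in `insert`.
foldr-lehmer : ∀ t n p → foldr (step (above t)) (toℕ p) (balls n) ≡ toℕ (lehmer t n ⟨$⟩ʳ p)
foldr-lehmer t (suc n) zero    =
  trans (foldr-balls-suc t n 0) (cong (rotate (toℕ (t n))) (foldr-embed-zero (above t) (balls n)))
foldr-lehmer t (suc n) (suc p) = begin
  foldr (step (above t)) (suc (toℕ p)) (balls (suc n))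
    ≡⟨ foldr-balls-suc t n (suc (toℕ p)) ⟩
  rotate (toℕ (t n)) (foldr (step (above t)) (suc (toℕ p)) (map embed (balls n)))
    ≡⟨ cong (rotate (toℕ (t n))) (foldr-embed-suc (above t) (toℕ p) (balls n)) ⟩
  punch (toℕ (t n)) (foldr (step (above t)) (toℕ p) (balls n))
    ≡⟨ cong (punch (toℕ (t n))) (foldr-lehmer t n p) ⟩
  punch (toℕ (t n)) (toℕ (lehmer t n ⟨$⟩ʳ p))
    ≡⟨ toℕ-insert-suc (t n) (lehmer t n) p ⟨
  toℕ (lehmer t (suc n) ⟨$⟩ʳ suc p) ∎
  where open ≡-Reasoning

π-above : ∀ t n → π {n} (above t) Perm.≈ lehmer t n
π-above t n p = toℕ-injective (trans (π-foldr (above t) p) (foldr-lehmer t n p))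

-- Bijectivity of the Lehmer code

lehmer-injective : ∀ t u n → lehmer t n Perm.≈ lehmer u n → ∀ {j} → j < n → t j ≡ u j
lehmer-injective t u (suc n) eq j<1+n with eq zero | m<1+n⇒m<n∨m≡n j<1+n
... | tn≡un | inj₂ refl = tn≡un
... | tn≡un | inj₁ j<n  = lehmer-injective t u n rest j<n
  where
  rest : lehmer t n Perm.≈ lehmer u n
  rest p = punchIn-injective (t n) _ _ (begin
    punchIn (t n) (lehmer t n ⟨$⟩ʳ p)   ≡⟨ insert-punchIn zero (t n) (lehmer t n) p ⟨
    lehmer t (suc n) ⟨$⟩ʳ suc p         ≡⟨ eq (suc p) ⟩
    lehmer u (suc n) ⟨$⟩ʳ suc p         ≡⟨ insert-punchIn zero (u n) (lehmer u n) p ⟩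
    punchIn (u n) (lehmer u n ⟨$⟩ʳ p)   ≡⟨ cong (λ c → punchIn c (lehmer u n ⟨$⟩ʳ p)) tn≡un ⟨
    punchIn (t n) (lehmer u n ⟨$⟩ʳ p)   ∎)
    where open ≡-Reasoning

lehmer-cong : ∀ {t u} n → (∀ {j} → j < n → t j ≡ u j) → lehmer t n Perm.≈ lehmer u n
lehmer-cong         zero    eq ()
lehmer-cong         (suc n) eq zero    = eq ≤-refl
lehmer-cong {t} {u} (suc n) eq (suc p) = begin
  lehmer t (suc n) ⟨$⟩ʳ suc p         ≡⟨ insert-punchIn zero (t n) (lehmer t n) p ⟩
  punchIn (t n) (lehmer t n ⟨$⟩ʳ p)   ≡⟨ cong₂ punchIn (eq ≤-refl) (lehmer-cong n (eq ∘ m<n⇒m<1+n) p) ⟩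
  punchIn (u n) (lehmer u n ⟨$⟩ʳ p)   ≡⟨ insert-punchIn zero (u n) (lehmer u n) p ⟨
  lehmer u (suc n) ⟨$⟩ʳ suc p         ∎
  where open ≡-Reasoning

-- Inverse of `lehmer`, with `remove` standardising the remainder. For σ of size n, every j ≥ n ends
-- at the default `zero`.
code : ∀ {n} → Permutation′ n → Thresholds
code {zero}  σ j = zero
code {suc n} σ j with j ≟ n
... | yes refl = σ ⟨$⟩ʳ zero
... | no  _    = code (remove zero σ) j

code-last : ∀ {n} (σ : Permutation′ (suc n)) → code σ n ≡ σ ⟨$⟩ʳ zero
code-last {n} σ with n ≟ n
... | yes refl = refl
... | no  n≢n  = contradiction refl n≢n

code-remove : ∀ {n} (σ : Permutation′ (suc n)) {j} → j < n → code σ j ≡ code (remove zero σ) j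
code-remove {n} σ {j} j<n with j ≟ n
... | yes refl = contradiction j<n (<-irrefl refl)
... | no  _    = refl

lehmer-code : ∀ {n} (σ : Permutation′ n) → lehmer (code σ) n Perm.≈ σ
lehmer-code {suc n} σ zero    = code-last σ
lehmer-code {suc n} σ (suc p) = begin
  lehmer (code σ) (suc n) ⟨$⟩ʳ suc p
    ≡⟨ insert-punchIn zero (code σ n) (lehmer (code σ) n) p ⟩
  punchIn (code σ n) (lehmer (code σ) n ⟨$⟩ʳ p)
    ≡⟨ cong₂ punchIn (code-last σ) (trans (lehmer-cong n (code-remove σ) p) (lehmer-code (remove zero σ) p)) ⟩
  punchIn (σ ⟨$⟩ʳ zero) (remove zero σ ⟨$⟩ʳ p)
    ≡⟨ insert-punchIn zero (σ ⟨$⟩ʳ zero) (remove zero σ) p ⟨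
  insert zero (σ ⟨$⟩ʳ zero) (remove zero σ) ⟨$⟩ʳ suc p
    ≡⟨ insert-remove zero σ (suc p) ⟩
  σ ⟨$⟩ʳ suc p ∎
  where open ≡-Reasoning

-- 213-avoidance of a permutation in terms of its thresholds

-- Meant for c put in front of σ by `insert`: punching raises exactly the values ≥ c, which thus end
-- up above the new entry. A failure supplies the 1 and the 3 of a pattern 213 whose 2 is c.
SmallLast : ∀ {n} → ℕ → Permutation′ n → Set
SmallLast c σ = ∀ p q → p Fin.< q → toℕ (σ ⟨$⟩ʳ p) < c → toℕ (σ ⟨$⟩ʳ q) < c

module _ {n} (c : Fin (suc n)) (σ : Permutation′ n) where

  private
    τ = insert zero c σ

    value : ∀ p → toℕ (τ ⟨$⟩ʳ suc p) ≡ punch (toℕ c) (toℕ (σ ⟨$⟩ʳ p))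
    value = toℕ-insert-suc c σ

    insert-mono : ∀ p q → (σ ⟨$⟩ʳ p) Fin.< (σ ⟨$⟩ʳ q) → (τ ⟨$⟩ʳ suc p) Fin.< (τ ⟨$⟩ʳ suc q)
    insert-mono p q = subst₂ _<_ (sym (value p)) (sym (value q)) ∘ punch-mono-< (toℕ c)

    insert-cancel : ∀ p q → (τ ⟨$⟩ʳ suc p) Fin.< (τ ⟨$⟩ʳ suc q) → (σ ⟨$⟩ʳ p) Fin.< (σ ⟨$⟩ʳ q)
    insert-cancel p q = punch-cancel-< (toℕ c) ∘ subst₂ _<_ (value p) (value q)

  -- A pattern 213 in τ either starts at position 0, where it is a failure of `SmallLast`, or lies
  -- in the remainder, whose order `punch` preserves.
  avoids-insert⁻ : Avoids213 τ → Avoids213 σ × SmallLast (toℕ c) σ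
  avoids-insert⁻ avoids = avoidsσ , smallLast
    where
    avoidsσ : Avoids213 σ
    avoidsσ (i , j , k , i<j , j<k , σj<σi , σi<σk) = avoids
      (suc i , suc j , suc k , s≤s i<j , s≤s j<k , insert-mono j i σj<σi , insert-mono i k σi<σk)

    smallLast : SmallLast (toℕ c) σ
    smallLast p q p<q σp<c = ≰⇒> λ c≤σq → avoids (zero , suc p , suc q , s≤s z≤n , s≤s p<q ,
      subst (_< toℕ c) (sym (trans (value p) (punch-< (toℕ c) σp<c))) σp<c ,
      subst (toℕ c <_) (sym (trans (value q) (punch-≥ (toℕ c) c≤σq))) (s≤s c≤σq))

  avoids-insert⁺ : Avoids213 σ → SmallLast (toℕ c) σ → Avoids213 τ
  avoids-insert⁺ avoids smallLast (zero , suc p , suc q , _ , s≤s p<q , τp<c , c<τq) =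
    <-asym c<τq (subst (_< toℕ c) (sym (trans (value q) (punch-< (toℕ c) σq<c))) σq<c)
    where
    σq<c : toℕ (σ ⟨$⟩ʳ q) < toℕ c
    σq<c = smallLast p q p<q
      (≤-<-trans (punch-inflationary (toℕ c) _) (subst (_< toℕ c) (value p) τp<c))
  avoids-insert⁺ avoids _ (suc i , suc j , suc k , s≤s i<j , s≤s j<k , τj<τi , τi<τk) =
    avoids (i , j , k , i<j , j<k , insert-cancel j i τj<τi , insert-cancel i k τi<τk)

-- The first entry is t n. Were it below c, every entry would be, yet the value n ≥ c occurs.
SmallLast⇒≤threshold : ∀ t n {c} → SmallLast c (lehmer t (suc n)) → c ≤ n → c ≤ toℕ (t n)
SmallLast⇒≤threshold t n {c} smallLast c≤n = ≮⇒≥ λ tn<c →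
  <⇒≱ (allSmall tn<c position-of-n) (subst (c ≤_) (sym value-n) c≤n)
  where
  position-of-n : Fin (suc n)
  position-of-n = lehmer t (suc n) ⟨$⟩ˡ fromℕ n

  value-n : toℕ (lehmer t (suc n) ⟨$⟩ʳ position-of-n) ≡ n
  value-n = trans (cong toℕ (inverseʳ (lehmer t (suc n)))) (toℕ-fromℕ n)

  allSmall : toℕ (t n) < c → ∀ p → toℕ (lehmer t (suc n) ⟨$⟩ʳ p) < c
  allSmall tn<c zero    = tn<c
  allSmall tn<c (suc p) = smallLast zero (suc p) (s≤s z≤n) tn<c

-- Since c ≤ t n by `SmallLast⇒≤threshold`, punching at t n leaves the values below c alone, and
-- `SmallLast` passes to the remainder.
SmallLast-lehmer⁻ : ∀ t n {c} → SmallLast c (lehmer t n) → ∀ {m} → c ≤ m → m < n → c ≤ toℕ (t m)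
SmallLast-lehmer⁻ t (suc n) {c} smallLast {m} c≤m m<1+n with m<1+n⇒m<n∨m≡n m<1+n
... | inj₂ refl = SmallLast⇒≤threshold t n smallLast c≤m
... | inj₁ m<n  = SmallLast-lehmer⁻ t n smallLast′ c≤m m<n
  where
  c≤tn : c ≤ toℕ (t n)
  c≤tn = SmallLast⇒≤threshold t n smallLast (≤-trans c≤m (<⇒≤ m<n))

  smallLast′ : SmallLast c (lehmer t n)
  smallLast′ p q p<q σp<c = ≤-<-trans (punch-inflationary (toℕ (t n)) _)
    (subst (_< c) (toℕ-insert-suc (t n) (lehmer t n) q)
      (smallLast (suc p) (suc q) (s≤s p<q)
        (subst (_< c) (sym (trans (toℕ-insert-suc (t n) (lehmer t n) p)
                                  (punch-< (toℕ (t n)) (<-≤-trans σp<c c≤tn)))) σp<c)))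

SmallLast-lehmer⁺ : ∀ t n {c} → c ≤ n → (∀ {m} → c ≤ m → m < n → c ≤ toℕ (t m)) → SmallLast c (lehmer t n)
SmallLast-lehmer⁺ t (suc n) {c} c≤1+n c≤t p q p<q σp<c with m≤n⇒m<n∨m≡n c≤1+n
-- Here c = n + 1 exceeds every value.
... | inj₂ refl = toℕ<n _
SmallLast-lehmer⁺ t (suc n) c≤1+n c≤t zero    q       _         tn<c | inj₁ c<1+n =
  contradiction (c≤t (s≤s⁻¹ c<1+n) ≤-refl) (<⇒≱ tn<c)
SmallLast-lehmer⁺ t (suc n) {c} c≤1+n c≤t (suc p) (suc q) (s≤s p<q) τp<c | inj₁ c<1+n =
  subst (_< c) (sym (trans (toℕ-insert-suc (t n) (lehmer t n) q)
                           (punch-< (toℕ (t n)) (<-≤-trans σq<c c≤tn)))) σq<c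
  where
  c≤tn : c ≤ toℕ (t n)
  c≤tn = c≤t (s≤s⁻¹ c<1+n) ≤-refl

  σq<c : toℕ (lehmer t n ⟨$⟩ʳ q) < c
  σq<c = SmallLast-lehmer⁺ t n (s≤s⁻¹ c<1+n) (λ c≤m m<n → c≤t c≤m (m<n⇒m<1+n m<n)) p q p<q
    (≤-<-trans (punch-inflationary (toℕ (t n)) _)
      (subst (_< c) (toℕ-insert-suc (t n) (lehmer t n) p) τp<c))

-- Any two of the intervals [ t j , j ], j < n, are disjoint or nested.
Noncrossing : Thresholds → ℕ → Set
Noncrossing t n = ∀ {m j} → j < n → toℕ (t j) ≤ m → m < j → toℕ (t j) ≤ toℕ (t m)

avoids⇒noncrossing : ∀ t n → Avoids213 (lehmer t n) → Noncrossing t n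
avoids⇒noncrossing t (suc n) avoids j<1+n tj≤m m<j
  with avoids-insert⁻ (t n) (lehmer t n) avoids | m<1+n⇒m<n∨m≡n j<1+n
... | avoids′ , _         | inj₁ j<n  = avoids⇒noncrossing t n avoids′ j<n tj≤m m<j
... | _       , smallLast | inj₂ refl = SmallLast-lehmer⁻ t n smallLast tj≤m m<j

noncrossing⇒avoids : ∀ t n → Noncrossing t n → Avoids213 (lehmer t n)
noncrossing⇒avoids t zero    _           (() , _)
noncrossing⇒avoids t (suc n) noncrossing = avoids-insert⁺ (t n) (lehmer t n)
  (noncrossing⇒avoids t n (noncrossing ∘ m<n⇒m<1+n))
  (SmallLast-lehmer⁺ t n (s≤s⁻¹ (toℕ<n (t n))) (noncrossing ≤-refl))

-- Torsion classes in terms of thresholds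

-- i ≤ t m says that [ i , m ] is not in `above t`. For i ≤ m ≤ j these balls are the subobjects of
-- [ i , j ], so torsion-free means having no subobject in the class.
torsionFree : Thresholds → ∀ {n} → BallSet n
torsionFree t Y = does (allUpTo? (λ m → Ball.i Y ≤? m →-dec Ball.i Y ≤? toℕ (t m)) (suc (Ball.j Y)))

noncrossing⇒torsion : ∀ t n → Noncrossing t n → IsTorsionPair {n} (above t) (torsionFree t)
noncrossing⇒torsion t n noncrossing = record
  { torsion = λ X → mk⇔ (λ X∈ Y Y∈ → orthogonal X Y X∈ Y∈) (complete X)
  ; free    = λ Y → mk⇔ (λ Y∈ X X∈ → orthogonal X Y X∈ Y∈) (λ hom≡0 → dec-true (isFree? Y) (isFree Y hom≡0))
  }
  where
  IsFree : Ball n → Set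
  IsFree Y = ∀ {m} → m < suc (Ball.j Y) → Ball.i Y ≤ m → Ball.i Y ≤ toℕ (t m)

  isFree? : ∀ Y → Dec (IsFree Y)
  isFree? Y = allUpTo? (λ m → Ball.i Y ≤? m →-dec Ball.i Y ≤? toℕ (t m)) (suc (Ball.j Y))

  -- The image of a nonzero map X → Y is [ i′ , j ]: freeness of `Y` gives i′ ≤ t j, but t j < i ≤
  -- i′.
  orthogonal : ∀ X Y → X ∈ above t → Y ∈ torsionFree t → Hom≡0 X Y
  orthogonal X Y X∈ Y∈ (i≤i′ , i′≤j , j≤j′) =
    <⇒≱ (does-true (toℕ (t (Ball.j X)) <? Ball.i X) X∈)
        (≤-trans i≤i′ (does-true (isFree? Y) Y∈ (s≤s j≤j′) i′≤j))

  isFree : ∀ Y → (∀ X → X ∈ above t → Hom≡0 X Y) → IsFree Y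
  isFree Y hom≡0 {m} (s≤s m≤j′) i′≤m = ≮⇒≥ λ tm<i′ →
    -- Test `Y` against its own subobject [ i′ , m ].
    hom≡0 (ball (Ball.i Y) m (1≤i Y) i′≤m (≤-<-trans m≤j′ (j<n Y)))
          (dec-true (toℕ (t m) <? Ball.i Y) tm<i′) (≤-refl , i′≤m , m≤j′)

  complete : ∀ X → (∀ Y → Y ∈ torsionFree t → Hom≡0 X Y) → X ∈ above t
  complete X hom≡0 = dec-true (c <? i) (≰⇒> λ i≤c →
    hom≡0 (Y i≤c) (dec-true (isFree? (Y i≤c)) isFreeY) (i≤c , c≤j , ≤-refl))
    where
    open Ball X using (i; j)
    c = toℕ (t j)

    c≤j : c ≤ j
    c≤j = s≤s⁻¹ (toℕ<n (t j))

    -- If i ≤ c, then `X` maps onto its quotient [ c , j ], which is torsion-free because t is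
    -- noncrossing.
    Y : i ≤ c → Ball n
    Y i≤c = ball c j (≤-trans (1≤i X) i≤c) c≤j (j<n X)

    isFreeY : ∀ {m} → m < suc j → c ≤ m → c ≤ toℕ (t m)
    isFreeY m<1+j c≤m with m<1+n⇒m<n∨m≡n m<1+j
    ... | inj₁ m<j  = noncrossing (j<n X) c≤m m<j
    ... | inj₂ refl = ≤-refl

-- Thresholds of a torsion class

lastGap : (ℕ → Bool) → Thresholds
-- The largest gap in 1, ..., j is sought; the default 0 stands for a column without gaps.
lastGap g zero    = zero
lastGap g (suc j) = if g (suc j) then inject₁ (lastGap g j) else fromℕ (suc j)

lastGap-above : ∀ g {i} j → toℕ (lastGap g j) < i → i ≤ j → g i ≡ true
lastGap-above g zero    gap<i z≤n = contradiction gap<i λ ()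
lastGap-above g {i} (suc j) gap<i i≤1+j with g (suc j) in eq
... | false = contradiction i≤1+j (<⇒≱ (subst (_< i) (toℕ-fromℕ (suc j)) gap<i))
... | true with m≤n⇒m<n∨m≡n i≤1+j
...   | inj₁ (s≤s i≤j) = lastGap-above g j (subst (_< i) (toℕ-inject₁ (lastGap g j)) gap<i) i≤j
...   | inj₂ refl      = eq

lastGap-gap : ∀ g j → 1 ≤ toℕ (lastGap g j) → g (toℕ (lastGap g j)) ≡ false
lastGap-gap g (suc j) 1≤gap with g (suc j) in eq
... | false = trans (cong g (toℕ-fromℕ (suc j))) eq
... | true  = trans (cong g (toℕ-inject₁ (lastGap g j)))
                    (lastGap-gap g j (subst (1 ≤_) (toℕ-inject₁ (lastGap g j)) 1≤gap))

coordinates : ∀ {n} → BallSet n → ℕ → ℕ → Bool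
coordinates G j i = maybe′ G false (mkBall? i j)

coordinates-ball : ∀ {n} (G : BallSet n) X → coordinates G (Ball.j X) (Ball.i X) ≡ G X
coordinates-ball G X = cong (maybe′ G false) (mkBall?-complete X)

threshold : ∀ {n} → BallSet n → Thresholds
threshold G j = lastGap (coordinates G j) j

module _ {n} {G F : BallSet n} (pair : IsTorsionPair G F) where
  open IsTorsionPair pair

  private
    t = threshold G

    -- A nonzero map from the quotient `Y` to Z gives one from `X`, by composition with X → Y.
    quotient-closed : ∀ X Y → Ball.i X ≤ Ball.i Y → Ball.j X ≡ Ball.j Y → X ∈ G → Y ∈ G
    quotient-closed X Y i≤i′ refl X∈ = from (torsion Y) λ Z Z∈ (i′≤k , k≤j , j≤l) →
      to (torsion X) X∈ Z Z∈ (≤-trans i≤i′ i′≤k , k≤j , j≤l)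

    above⇒∈ : ∀ X → toℕ (t (Ball.j X)) < Ball.i X → X ∈ G
    above⇒∈ X c<i = trans (sym (coordinates-ball G X)) (lastGap-above (coordinates G _) _ c<i (i≤j X))

    -- If i ≤ t j, then [ t j , j ] is a quotient of `X` and would lie in `G`, but it is the gap
    -- that defines t j.
    ∈⇒above : ∀ X → X ∈ G → toℕ (t (Ball.j X)) < Ball.i X
    ∈⇒above X X∈ = ≰⇒> λ i≤c → true≢false (trans (sym (quotient-closed X (Y i≤c) i≤c refl X∈))
      (trans (sym (coordinates-ball G (Y i≤c))) (lastGap-gap (coordinates G _) _ (≤-trans (1≤i X) i≤c))))
      where
      Y : Ball.i X ≤ toℕ (t (Ball.j X)) → Ball n
      Y i≤c = ball _ (Ball.j X) (≤-trans (1≤i X) i≤c) (s≤s⁻¹ (toℕ<n (t (Ball.j X)))) (j<n X)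

      true≢false : true ≢ false
      true≢false ()

  torsion⇒above : G ≗ above t
  torsion⇒above X with toℕ (t (Ball.j X)) <? Ball.i X
  ... | yes c<i = trans (above⇒∈ X c<i) (sym (dec-true (_ <? _) c<i))
  ... | no  c≮i = trans (¬-not (c≮i ∘ ∈⇒above X)) (sym (dec-false (_ <? _) c≮i))

  -- Closure under extensions: if t m < c = t j ≤ m < j, then [ c , m ] and [ m + 1 , j ] lie in
  -- `G`, hence so does [ c , j ], against c = t j.
  torsion⇒noncrossing : Noncrossing t n
  torsion⇒noncrossing {m} {j} j<n c≤m m<j = ≮⇒≥ λ tm<c →
    <-irrefl refl (∈⇒above (E tm<c) (extension tm<c))
    where
    c = toℕ (t j)

    c≤j : c ≤ j
    c≤j = ≤-trans c≤m (<⇒≤ m<j)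

    E Sub : toℕ (t m) < c → Ball n
    E   tm<c = ball c j (≤-trans (s≤s z≤n) tm<c) c≤j j<n
    Sub tm<c = ball c m (≤-trans (s≤s z≤n) tm<c) c≤m (<-trans m<j j<n)

    Quotient : Ball n
    Quotient = ball (suc m) j (s≤s z≤n) m<j j<n

    extension : ∀ tm<c → E tm<c ∈ G
    extension tm<c = from (torsion (E tm<c)) orthogonal
      where
      orthogonal : ∀ Y → Y ∈ F → Hom≡0 (E tm<c) Y
      -- A nonzero map from [ c , j ] stays nonzero on [ c , m ] if i′ ≤ m, and factors through
      -- [ m + 1 , j ] otherwise.
      orthogonal Y Y∈ (c≤i′ , i′≤j , j≤j′) with Ball.i Y ≤? m
      ... | yes i′≤m = to (torsion (Sub tm<c)) (above⇒∈ (Sub tm<c) tm<c) Y Y∈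
                         (c≤i′ , i′≤m , ≤-trans (<⇒≤ m<j) j≤j′)
      ... | no  i′≰m = to (torsion Quotient) (above⇒∈ Quotient (s≤s c≤m)) Y Y∈
                         (≰⇒> i′≰m , i′≤j , j≤j′)

-- The bijection

avoids-resp-≈ : ∀ {n} (σ τ : Permutation′ n) → σ Perm.≈ τ → Avoids213 σ → Avoids213 τ
avoids-resp-≈ σ τ σ≈τ avoids (i , j , k , i<j , j<k , τj<τi , τi<τk) = avoids
  (i , j , k , i<j , j<k ,
   subst₂ Fin._<_ (sym (σ≈τ j)) (sym (σ≈τ i)) τj<τi , subst₂ Fin._<_ (sym (σ≈τ i)) (sym (σ≈τ k)) τi<τk)

π-lehmer : ∀ {n} ((G , _) : TorsionClass n) → π G Perm.≈ lehmer (threshold G) n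
π-lehmer {n} (G , _ , pair) p =
  trans (π-cong {H = above (threshold G)} (torsion⇒above pair) p) (π-above (threshold G) n p)

mainTheorem9 : (n : ℕ) → n ≥ 1 →
    Σ ((G : TorsionClass n) → Avoids213 (π (proj₁ G))) λ avoids →
    IsBijection (_≈ᵗ_ {n}) (_≈ᵖ_ {n}) (λ G → π (proj₁ G) , avoids G)
mainTheorem9 n _ = avoids , record
  { isInjection = record
    { isCongruent = record
      { cong           = λ {G} {H} G≗H → π-cong {G = proj₁ G} {H = proj₁ H} G≗H
      ; isEquivalence₁ = record
        { refl  = λ _ → refl
        ; sym   = λ G≗H X → sym (G≗H X)
        ; trans = λ G≗H H≗K X → trans (G≗H X) (H≗K X)
        }
      ; isEquivalence₂ = record
        { refl  = λ _ → refl
        ; sym   = λ σ≈τ p → sym (σ≈τ p)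
        ; trans = λ σ≈τ τ≈υ p → trans (σ≈τ p) (τ≈υ p)
        }
      }
    ; injective = λ {G} {H} → injective G H
    }
  ; surjective = surjective
  }
  where
  avoids : (G : TorsionClass n) → Avoids213 (π (proj₁ G))
  avoids G@(G′ , _ , pair) = avoids-resp-≈ (lehmer (threshold G′) n) (π G′) (λ p → sym (π-lehmer G p))
    (noncrossing⇒avoids (threshold G′) n (torsion⇒noncrossing pair))

  -- A torsion class is recovered from its thresholds, and these are the Lehmer code of its
  -- permutation.
  injective : ∀ (G H : TorsionClass n) → π (proj₁ G) Perm.≈ π (proj₁ H) → proj₁ G ≗ proj₁ H
  injective G@(G′ , _ , pairG) H@(H′ , _ , pairH) πG≈πH X = begin
    G′ X                      ≡⟨ torsion⇒above pairG X ⟩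
    above (threshold G′) X    ≡⟨ cong (λ c → does (toℕ c <? Ball.i X))
                                   (lehmer-injective (threshold G′) (threshold H′) n lehmers (j<n X)) ⟩
    above (threshold H′) X    ≡⟨ torsion⇒above pairH X ⟨
    H′ X                      ∎
    where
    open ≡-Reasoning
    lehmers : lehmer (threshold G′) n Perm.≈ lehmer (threshold H′) n
    lehmers p = trans (sym (π-lehmer G p)) (trans (πG≈πH p) (π-lehmer H p))

  -- The preimage takes the Lehmer code of σ as thresholds, noncrossing because σ avoids 213.
  surjective : ∀ (σ : Av213 n) → ∃[ G ] (∀ {H : TorsionClass n} → H ≈ᵗ G → π (proj₁ H) Perm.≈ proj₁ σ)
  surjective (σ , avoidsσ) = (above t , torsionFree t , noncrossing⇒torsion t n noncrossing) ,
    λ {H} H≗G p → trans (π-cong {G = proj₁ H} {H = above t} H≗G p) (trans (π-above t n p) (lehmer-code σ p))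
    where
    t = code σ

    noncrossing : Noncrossing t n
    noncrossing = avoids⇒noncrossing t n
      (avoids-resp-≈ σ (lehmer t n) (λ p → sym (lehmer-code σ p)) avoidsσ)
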